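{- Let $P, Q$ be nonzero real numbers with $\Delta := P^2 - 4Q > 0$, and let $(U_n)_{n\in\mathbb{Z}}$ and $\beta$ be as in the context. Let $(a_n)_{n \geq 1}$ be a sequence of positive integers tending to infinity with $n$, and let $k$ be a positive integer. Then the series on the left below converges and $$\sum_{n = 1}^{+\infty} Q^{a_n} \frac{U_{a_{n + k} - a_n}}{U_{a_n} U_{a_{n + k}}} = \sum_{n = 1}^{k} \frac{\beta^{a_n}}{U_{a_n}}.$$
   Context: $P, Q$ are fixed nonzero real numbers with $\Delta := P^2 - 4Q > 0$. $\alpha$ and $\beta$ denote the two real roots of $X^2 - PX + Q = 0$, labelled so that $|\alpha| > |\beta|$ (the absolute values are distinct because $P \neq 0$ and $\Delta > 0$). The Lucas sequence of the first kind $(U_n)_{n \in \mathbb{Z}}$ is defined by $U_0 = 0$, $U_1 = 1$ and $U_{n+2} = P U_{n+1} - Q U_n$ for all $n \in \mathbb{Z}$; equivalently $U_n = \frac{\alpha^n - \beta^n}{\alpha - \beta}$ for all $n\in\mathbb{Z}$. Infinite sums $\sum_{n=1}^{+\infty}$ are understood as limits of partial sums (absolute convergence is not claimed). -}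

module Defs where

open import Algebra.Bundles using (RawRing)
import Algebra.Definitions.RawSemiring as RawSemiringOps
open import Data.Fin.Base using (toℕ)
open import Data.Integer.Base as ℤ using (ℤ; +_)
open import Data.Nat.Base as ℕ using (ℕ; suc; NonZero)
import Data.Nat.Properties as ℕ
open import Data.Product.Base using (∃-syntax; _×_; _,_; proj₁; proj₂)
open import Data.Rational.Base as ℚ using (ℚ; 0ℚ; 1ℚ; ½)
import Data.Rational.Properties as ℚ
open import Data.Rational.Solver using (module +-*-Solver)
open import Data.Sum.Base using (_⊎_; inj₁; inj₂)
open import Level using (0ℓ)
open import Relation.Binary.PropositionalEquality
  using (_≡_; refl; sym; trans; cong; cong₂; subst; subst₂)
open import Relation.Nullary using (yes; no; contradiction)

open +-*-Solver using (solve; _:=_) renaming (_:+_ to _⊕_; _:*_ to _⊗_; _:-_ to _⊝_; :-_ to ⊝_)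

-- ℝ is the setoid of Cauchy sequences of rationals, two sequences being
-- equal when their difference tends to 0.  The ring operations act
-- termwise.  Being a Cauchy sequence carries its modulus as data.

IsCauchy : (ℕ → ℚ) → Set
IsCauchy s = ∀ ε → 0ℚ ℚ.< ε →
  ∃[ N ] (∀ m n → N ℕ.≤ m → N ℕ.≤ n → ℚ.∣ s m ℚ.- s n ∣ ℚ.< ε)

record ℝ : Set where
  constructor mkℝ
  field
    seq    : ℕ → ℚ
    cauchy : IsCauchy seq

open ℝ public

fromℚ : ℚ → ℝ
fromℚ q = mkℝ (λ _ → q) λ ε 0<ε → 0 , λ _ _ _ _ →
  subst (λ r → ℚ.∣ r ∣ ℚ.< ε) (sym (ℚ.+-inverseʳ q)) 0<ε

0ℝ 1ℝ : ℝ
0ℝ = fromℚ 0ℚ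
1ℝ = fromℚ 1ℚ

infix 4 _≈_ _<_ _#_

_≈_ : ℝ → ℝ → Set
x ≈ y = ∀ ε → 0ℚ ℚ.< ε →
  ∃[ N ] (∀ n → N ℕ.≤ n → ℚ.∣ seq x n ℚ.- seq y n ∣ ℚ.< ε)

_<_ : ℝ → ℝ → Set
x < y = ∃[ δ ] (0ℚ ℚ.< δ × ∃[ N ] (∀ n → N ℕ.≤ n → seq x n ℚ.+ δ ℚ.≤ seq y n))

-- Apartness, the constructive form of "x and y are different".
_#_ : ℝ → ℝ → Set
x # y = x < y ⊎ y < x

module Estimates where
  pos-* : ∀ {p q} → 0ℚ ℚ.< p → 0ℚ ℚ.< q → 0ℚ ℚ.< p ℚ.* q
  pos-* {p} {q} 0<p 0<q =
    ℚ.positive⁻¹ _ {{ℚ.pos*pos⇒pos p {{ℚ.positive 0<p}} q {{ℚ.positive 0<q}}}}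

  p≤∣p∣ : ∀ p → p ℚ.≤ ℚ.∣ p ∣
  p≤∣p∣ p with ℚ.≤-total 0ℚ p
  ... | inj₁ 0≤p = ℚ.≤-reflexive (sym (ℚ.0≤p⇒∣p∣≡p 0≤p))
  ... | inj₂ p≤0 = ℚ.≤-trans p≤0 (ℚ.0≤∣p∣ p)

  -p≤∣p∣ : ∀ p → ℚ.- p ℚ.≤ ℚ.∣ p ∣
  -p≤∣p∣ p = subst (ℚ.- p ℚ.≤_) (ℚ.∣-p∣≡∣p∣ p) (p≤∣p∣ (ℚ.- p))

  ∣p-q∣≡∣q-p∣ : ∀ p q → ℚ.∣ p ℚ.- q ∣ ≡ ℚ.∣ q ℚ.- p ∣
  ∣p-q∣≡∣q-p∣ p q = trans (sym (ℚ.∣-p∣≡∣p∣ (p ℚ.- q)))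
    (cong ℚ.∣_∣ (solve 2 (λ p q → ⊝ (p ⊝ q) := q ⊝ p) refl p q))

  ∣p∣≤∣p-q∣+∣q∣ : ∀ p q → ℚ.∣ p ∣ ℚ.≤ ℚ.∣ p ℚ.- q ∣ ℚ.+ ℚ.∣ q ∣
  ∣p∣≤∣p-q∣+∣q∣ p q = subst (λ r → ℚ.∣ r ∣ ℚ.≤ ℚ.∣ p ℚ.- q ∣ ℚ.+ ℚ.∣ q ∣)
    (solve 2 (λ p q → (p ⊝ q) ⊕ q := p) refl p q)
    (ℚ.∣p+q∣≤∣p∣+∣q∣ (p ℚ.- q) q)

  ∣p∣-∣q∣≤∣p-q∣ : ∀ p q → ℚ.∣ p ∣ ℚ.- ℚ.∣ q ∣ ℚ.≤ ℚ.∣ p ℚ.- q ∣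
  ∣p∣-∣q∣≤∣p-q∣ p q = subst (ℚ.∣ p ∣ ℚ.- ℚ.∣ q ∣ ℚ.≤_)
    (solve 2 (λ r s → (r ⊕ s) ⊝ s := r) refl ℚ.∣ p ℚ.- q ∣ ℚ.∣ q ∣)
    (ℚ.+-monoˡ-≤ (ℚ.- ℚ.∣ q ∣) (∣p∣≤∣p-q∣+∣q∣ p q))

  ∣∣p∣-∣q∣∣≤∣p-q∣ : ∀ p q → ℚ.∣ ℚ.∣ p ∣ ℚ.- ℚ.∣ q ∣ ∣ ℚ.≤ ℚ.∣ p ℚ.- q ∣
  ∣∣p∣-∣q∣∣≤∣p-q∣ p q with ℚ.∣p∣≡p∨∣p∣≡-p (ℚ.∣ p ∣ ℚ.- ℚ.∣ q ∣)
  ... | inj₁ eq = subst (ℚ._≤ ℚ.∣ p ℚ.- q ∣) (sym eq) (∣p∣-∣q∣≤∣p-q∣ p q)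
  ... | inj₂ eq = subst₂ ℚ._≤_
    (trans (solve 2 (λ r s → s ⊝ r := ⊝ (r ⊝ s)) refl ℚ.∣ p ∣ ℚ.∣ q ∣) (sym eq))
    (∣p-q∣≡∣q-p∣ q p)
    (∣p∣-∣q∣≤∣p-q∣ q p)

  *-∣∣-< : ∀ {B δ} p d → 0ℚ ℚ.< δ → ℚ.∣ p ∣ ℚ.< B → ℚ.∣ d ∣ ℚ.< δ →
           ℚ.∣ p ℚ.* d ∣ ℚ.< B ℚ.* δ
  *-∣∣-< {B} {δ} p d 0<δ p<B d<δ = begin-strict
    ℚ.∣ p ℚ.* d ∣       ≡⟨ ℚ.∣p*q∣≡∣p∣*∣q∣ p d ⟩
    ℚ.∣ p ∣ ℚ.* ℚ.∣ d ∣ ≤⟨ ℚ.*-monoˡ-≤-nonNeg ℚ.∣ p ∣ {{ℚ.∣-∣-nonNeg p}} (ℚ.<⇒≤ d<δ) ⟩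
    ℚ.∣ p ∣ ℚ.* δ       <⟨ ℚ.*-monoˡ-<-pos δ {{ℚ.positive 0<δ}} p<B ⟩
    B ℚ.* δ             ∎
    where open ℚ.≤-Reasoning

  +-estimate : ∀ p q r s {δ η} → ℚ.∣ p ℚ.- r ∣ ℚ.< δ → ℚ.∣ q ℚ.- s ∣ ℚ.< η →
               ℚ.∣ (p ℚ.+ q) ℚ.- (r ℚ.+ s) ∣ ℚ.< δ ℚ.+ η
  +-estimate p q r s {δ} {η} p-r<δ q-s<η = begin-strict
    ℚ.∣ (p ℚ.+ q) ℚ.- (r ℚ.+ s) ∣
      ≡⟨ cong ℚ.∣_∣ (solve 4 (λ p q r s → (p ⊕ q) ⊝ (r ⊕ s) := (p ⊝ r) ⊕ (q ⊝ s)) refl p q r s) ⟩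
    ℚ.∣ (p ℚ.- r) ℚ.+ (q ℚ.- s) ∣
      ≤⟨ ℚ.∣p+q∣≤∣p∣+∣q∣ (p ℚ.- r) (q ℚ.- s) ⟩
    ℚ.∣ p ℚ.- r ∣ ℚ.+ ℚ.∣ q ℚ.- s ∣
      <⟨ ℚ.+-mono-< p-r<δ q-s<η ⟩
    δ ℚ.+ η ∎
    where open ℚ.≤-Reasoning

  *-estimate : ∀ p q r s {A B δ} → 0ℚ ℚ.< δ → ℚ.∣ p ∣ ℚ.< A → ℚ.∣ s ∣ ℚ.< B →
               ℚ.∣ p ℚ.- r ∣ ℚ.< δ → ℚ.∣ q ℚ.- s ∣ ℚ.< δ →
               ℚ.∣ p ℚ.* q ℚ.- r ℚ.* s ∣ ℚ.< (A ℚ.+ B) ℚ.* δ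
  *-estimate p q r s {A} {B} {δ} 0<δ p<A s<B p-r<δ q-s<δ = begin-strict
    ℚ.∣ p ℚ.* q ℚ.- r ℚ.* s ∣
      ≡⟨ cong ℚ.∣_∣ (solve 4 (λ p q r s → p ⊗ q ⊝ r ⊗ s := p ⊗ (q ⊝ s) ⊕ s ⊗ (p ⊝ r)) refl p q r s) ⟩
    ℚ.∣ p ℚ.* (q ℚ.- s) ℚ.+ s ℚ.* (p ℚ.- r) ∣
      ≤⟨ ℚ.∣p+q∣≤∣p∣+∣q∣ (p ℚ.* (q ℚ.- s)) (s ℚ.* (p ℚ.- r)) ⟩
    ℚ.∣ p ℚ.* (q ℚ.- s) ∣ ℚ.+ ℚ.∣ s ℚ.* (p ℚ.- r) ∣
      <⟨ ℚ.+-mono-< (*-∣∣-< p (q ℚ.- s) 0<δ p<A q-s<δ) (*-∣∣-< s (p ℚ.- r) 0<δ s<B p-r<δ) ⟩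
    A ℚ.* δ ℚ.+ B ℚ.* δ
      ≡⟨ sym (ℚ.*-distribʳ-+ δ A B) ⟩
    (A ℚ.+ B) ℚ.* δ ∎
    where open ℚ.≤-Reasoning

  inverse-estimate : ∀ p q i j {c ε} → 0ℚ ℚ.< c → c ℚ.≤ ℚ.∣ p ∣ → c ℚ.≤ ℚ.∣ q ∣ →
                     p ℚ.* i ≡ 1ℚ → q ℚ.* j ≡ 1ℚ →
                     ℚ.∣ q ℚ.- p ∣ ℚ.< c ℚ.* c ℚ.* ε → ℚ.∣ i ℚ.- j ∣ ℚ.< ε
  inverse-estimate p q i j {c} {ε} 0<c c≤p c≤q pi≡1 qj≡1 q-p<ccε =
    ℚ.*-cancelˡ-<-nonNeg (c ℚ.* c) {{ℚ.nonNegative (ℚ.<⇒≤ (pos-* 0<c 0<c))}} (begin-strict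
    c ℚ.* c ℚ.* ℚ.∣ i ℚ.- j ∣
      ≤⟨ ℚ.*-monoʳ-≤-nonNeg ℚ.∣ i ℚ.- j ∣ {{ℚ.∣-∣-nonNeg (i ℚ.- j)}}
           (ℚ.≤-trans (ℚ.*-monoʳ-≤-nonNeg c {{ℚ.nonNegative (ℚ.<⇒≤ 0<c)}} c≤p)
                      (ℚ.*-monoˡ-≤-nonNeg ℚ.∣ p ∣ {{ℚ.∣-∣-nonNeg p}} c≤q)) ⟩
    ℚ.∣ p ∣ ℚ.* ℚ.∣ q ∣ ℚ.* ℚ.∣ i ℚ.- j ∣
      ≡⟨ trans (cong (ℚ._* ℚ.∣ i ℚ.- j ∣) (sym (ℚ.∣p*q∣≡∣p∣*∣q∣ p q)))
               (sym (ℚ.∣p*q∣≡∣p∣*∣q∣ (p ℚ.* q) (i ℚ.- j))) ⟩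
    ℚ.∣ p ℚ.* q ℚ.* (i ℚ.- j) ∣
      ≡⟨ cong ℚ.∣_∣ (solve 4 (λ p q i j → p ⊗ q ⊗ (i ⊝ j) := q ⊗ (p ⊗ i) ⊝ p ⊗ (q ⊗ j)) refl p q i j) ⟩
    ℚ.∣ q ℚ.* (p ℚ.* i) ℚ.- p ℚ.* (q ℚ.* j) ∣
      ≡⟨ cong₂ (λ u v → ℚ.∣ q ℚ.* u ℚ.- p ℚ.* v ∣) pi≡1 qj≡1 ⟩
    ℚ.∣ q ℚ.* 1ℚ ℚ.- p ℚ.* 1ℚ ∣
      ≡⟨ cong₂ (λ u v → ℚ.∣ u ℚ.- v ∣) (ℚ.*-identityʳ q) (ℚ.*-identityʳ p) ⟩
    ℚ.∣ q ℚ.- p ∣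
      <⟨ q-p<ccε ⟩
    c ℚ.* c ℚ.* ε ∎)
    where open ℚ.≤-Reasoning

  half+half : ∀ ε → ε ℚ.* ½ ℚ.+ ε ℚ.* ½ ≡ ε
  half+half ε = trans (sym (ℚ.*-distribˡ-+ ε ½ ½)) (ℚ.*-identityʳ ε)

  rescale : ∀ {C ε} → 0ℚ ℚ.< C → 0ℚ ℚ.< ε → ∃[ δ ] (0ℚ ℚ.< δ × C ℚ.* δ ≡ ε)
  rescale {C} {ε} 0<C 0<ε = ε ℚ.* 1/C
    , pos-* 0<ε (ℚ.positive⁻¹ 1/C {{ℚ.1/pos⇒pos C {{ℚ.positive 0<C}}}})
    , trans (solve 3 (λ c ε i → c ⊗ (ε ⊗ i) := ε ⊗ (c ⊗ i)) refl C ε 1/C)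
      (trans (cong (ε ℚ.*_) (ℚ.*-inverseʳ C {{ℚ.>-nonZero 0<C}})) (ℚ.*-identityʳ ε))
    where
    1/C : ℚ
    1/C = (ℚ.1/ C) {{ℚ.>-nonZero 0<C}}

  eventually-bounded : (x : ℝ) →
    ∃[ B ] (0ℚ ℚ.< B × ∃[ N ] (∀ n → N ℕ.≤ n → ℚ.∣ seq x n ∣ ℚ.< B))
  eventually-bounded x with cauchy x 1ℚ (ℚ.positive⁻¹ 1ℚ)
  ... | N , h = 1ℚ ℚ.+ ℚ.∣ seq x N ∣
    , ℚ.+-mono-<-≤ (ℚ.positive⁻¹ 1ℚ) (ℚ.0≤∣p∣ (seq x N))
    , N
    , λ n N≤n → ℚ.≤-<-trans (∣p∣≤∣p-q∣+∣q∣ (seq x n) (seq x N))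
                  (ℚ.+-monoˡ-< ℚ.∣ seq x N ∣ (h n N N≤n ℕ.≤-refl))

  apart⇒bounded-below : ∀ {x} → x # 0ℝ →
    ∃[ c ] (0ℚ ℚ.< c × ∃[ N ] (∀ n → N ℕ.≤ n → c ℚ.≤ ℚ.∣ seq x n ∣))
  apart⇒bounded-below {x} (inj₁ (c , 0<c , N , h)) = c , 0<c , N , λ n N≤n →
    ℚ.≤-trans
      (subst₂ ℚ._≤_ (solve 2 (λ s c → (s ⊕ c) ⊝ s := c) refl (seq x n) c)
                    (ℚ.+-identityˡ (ℚ.- seq x n))
                    (ℚ.+-monoˡ-≤ (ℚ.- seq x n) (h n N≤n)))
      (-p≤∣p∣ (seq x n))
  apart⇒bounded-below {x} (inj₂ (c , 0<c , N , h)) = c , 0<c , N , λ n N≤n →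
    ℚ.≤-trans (subst (ℚ._≤ seq x n) (ℚ.+-identityˡ c) (h n N≤n)) (p≤∣p∣ (seq x n))

open Estimates

infixl 6 _+_ _-_
infixl 7 _*_ _/_[_]
infix  8 -_

_+_ : ℝ → ℝ → ℝ
x + y = mkℝ (λ n → seq x n ℚ.+ seq y n) λ ε 0<ε →
  let 0<ε/2 = pos-* 0<ε (ℚ.positive⁻¹ ½)
      M , f = cauchy x (ε ℚ.* ½) 0<ε/2
      N , g = cauchy y (ε ℚ.* ½) 0<ε/2
  in M ℕ.⊔ N , λ m n m≥ n≥ →
    subst (ℚ.∣ (seq x m ℚ.+ seq y m) ℚ.- (seq x n ℚ.+ seq y n) ∣ ℚ.<_) (half+half ε)
      (+-estimate (seq x m) (seq y m) (seq x n) (seq y n)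
        (f m n (ℕ.m⊔n≤o⇒m≤o M N m≥) (ℕ.m⊔n≤o⇒m≤o M N n≥))
        (g m n (ℕ.m⊔n≤o⇒n≤o M N m≥) (ℕ.m⊔n≤o⇒n≤o M N n≥)))

-_ : ℝ → ℝ
- x = mkℝ (λ n → ℚ.- seq x n) λ ε 0<ε →
  let N , h = cauchy x ε 0<ε in
  N , λ m n m≥ n≥ → subst (ℚ._< ε)
    (trans (∣p-q∣≡∣q-p∣ (seq x m) (seq x n))
           (cong ℚ.∣_∣ (solve 2 (λ p q → q ⊝ p := (⊝ p) ⊝ (⊝ q)) refl (seq x m) (seq x n))))
    (h m n m≥ n≥)

_-_ : ℝ → ℝ → ℝ
x - y = x + - y

_*_ : ℝ → ℝ → ℝ
x * y = mkℝ (λ n → seq x n ℚ.* seq y n) λ ε 0<ε →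
  let A , 0<A , K , a = eventually-bounded x
      B , 0<B , L , b = eventually-bounded y
      δ , 0<δ , eq    = rescale (ℚ.+-mono-< 0<A 0<B) 0<ε
      M , f           = cauchy x δ 0<δ
      N , g           = cauchy y δ 0<δ
  in (K ℕ.⊔ L) ℕ.⊔ (M ℕ.⊔ N) , λ m n m≥ n≥ →
    let m≥KL = ℕ.m⊔n≤o⇒m≤o (K ℕ.⊔ L) (M ℕ.⊔ N) m≥
        n≥KL = ℕ.m⊔n≤o⇒m≤o (K ℕ.⊔ L) (M ℕ.⊔ N) n≥
        m≥MN = ℕ.m⊔n≤o⇒n≤o (K ℕ.⊔ L) (M ℕ.⊔ N) m≥
        n≥MN = ℕ.m⊔n≤o⇒n≤o (K ℕ.⊔ L) (M ℕ.⊔ N) n≥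
    in subst (ℚ.∣ seq x m ℚ.* seq y m ℚ.- seq x n ℚ.* seq y n ∣ ℚ.<_) eq
         (*-estimate (seq x m) (seq y m) (seq x n) (seq y n) 0<δ
           (a m (ℕ.m⊔n≤o⇒m≤o K L m≥KL)) (b n (ℕ.m⊔n≤o⇒n≤o K L n≥KL))
           (f m n (ℕ.m⊔n≤o⇒m≤o M N m≥MN) (ℕ.m⊔n≤o⇒m≤o M N n≥MN))
           (g m n (ℕ.m⊔n≤o⇒n≤o M N m≥MN) (ℕ.m⊔n≤o⇒n≤o M N n≥MN)))

∣_∣ : ℝ → ℝ
∣ x ∣ = mkℝ (λ n → ℚ.∣ seq x n ∣) λ ε 0<ε →
  let N , h = cauchy x ε 0<ε in
  N , λ m n m≥ n≥ → ℚ.≤-<-trans (∣∣p∣-∣q∣∣≤∣p-q∣ (seq x m) (seq x n)) (h m n m≥ n≥)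

-- Total reciprocal on ℚ.  When x # 0ℝ only finitely many terms of x can
-- vanish, so the junk value at 0ℚ does not affect the real inv x.
recip : ℚ → ℚ
recip q with q ℚ.≟ 0ℚ
... | yes _  = 0ℚ
... | no q≢0 = (ℚ.1/ q) {{ℚ.≢-nonZero q≢0}}

module Reciprocal where
  *-recip : ∀ {c} q → 0ℚ ℚ.< c → c ℚ.≤ ℚ.∣ q ∣ → q ℚ.* recip q ≡ 1ℚ
  *-recip q 0<c c≤∣q∣ with q ℚ.≟ 0ℚ
  ... | yes refl = contradiction (ℚ.<-≤-trans 0<c c≤∣q∣) (ℚ.<-irrefl refl)
  ... | no q≢0   = ℚ.*-inverseʳ q {{ℚ.≢-nonZero q≢0}}

open Reciprocal

inv : (x : ℝ) → x # 0ℝ → ℝ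
inv x x#0 = mkℝ (λ n → recip (seq x n)) λ ε 0<ε →
  let c , 0<c , K , lb = apart⇒bounded-below {x} x#0
      N , h            = cauchy x (c ℚ.* c ℚ.* ε) (pos-* (pos-* 0<c 0<c) 0<ε)
  in K ℕ.⊔ N , λ m n m≥ n≥ →
    let c≤p = lb m (ℕ.m⊔n≤o⇒m≤o K N m≥)
        c≤q = lb n (ℕ.m⊔n≤o⇒m≤o K N n≥)
    in inverse-estimate (seq x m) (seq x n) (recip (seq x m)) (recip (seq x n)) 0<c c≤p c≤q
         (*-recip (seq x m) 0<c c≤p) (*-recip (seq x n) 0<c c≤q)
         (h n m (ℕ.m⊔n≤o⇒n≤o K N n≥) (ℕ.m⊔n≤o⇒n≤o K N m≥))

_/_[_] : (x y : ℝ) → y # 0ℝ → ℝ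
x / y [ y#0 ] = x * inv y y#0

+-*-rawRing : RawRing 0ℓ 0ℓ
+-*-rawRing = record
  { Carrier = ℝ
  ; _≈_     = _≈_
  ; _+_     = _+_
  ; _*_     = _*_
  ; -_      = -_
  ; 0#      = 0ℝ
  ; 1#      = 1ℝ
  }

open RawSemiringOps (RawRing.rawSemiring +-*-rawRing) public using (_^_; sum)

infix 4 _⟶_

_⟶_ : (ℕ → ℝ) → ℝ → Set
s ⟶ l = ∀ ε → 0ℝ < ε → ∃[ N ] (∀ n → N ℕ.≤ n → ∣ s n - l ∣ < ε)

Σ₁ : ℕ → ((n : ℕ) → .{{NonZero n}} → ℝ) → ℝ
Σ₁ N f = sum {N} (λ i → f (suc (toℕ i)))

SumsTo : ((n : ℕ) → .{{NonZero n}} → ℝ) → ℝ → Set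
SumsTo f l = (λ N → Σ₁ N f) ⟶ l

TendsToInfinity : (ℕ → ℕ) → Set
TendsToInfinity a = ∀ M → ∃[ N ] (∀ n → N ℕ.≤ n → M ℕ.≤ a n)

-- For Q # 0ℝ these equations determine U on all of ℤ up to _≈_.
record IsLucas (P Q : ℝ) (U : ℤ → ℝ) : Set where
  field
    U₀         : U (+ 0) ≈ 0ℝ
    U₁         : U (+ 1) ≈ 1ℝ
    recurrence : ∀ n → U (n ℤ.+ + 2) ≈ P * U (n ℤ.+ + 1) - Q * U n

IsRoot : (P Q x : ℝ) → Set
IsRoot P Q x = x ^ 2 - P * x + Q ≈ 0ℝ

{-# OPTIONS --safe #-}

-- Put b n = β ^ a n / U (a n).  From U (m + 1) = α U m + β ^ m one gets
-- Q ^ m U (l - m) = β ^ m U l - β ^ l U m, so the n-th term of the series is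
-- b n - b (n + k) and the N-th partial sum differs from b 1 + ... + b k by
-- b (N + 1) + ... + b (N + k).  This tail tends to 0: if ∣ β ∣ + δ ≤ ∣ α ∣, then
-- Bernoulli's inequality applied to ∣ α ^ m - β ^ m ∣ gives
-- m δ ∣ β ^ m / U m ∣ ≤ ∣ (α - β) β ∣, and a n tends to infinity.

module Submission where

open import Defs
import Algebra.Definitions.RawSemiring as RawSemiringOps
open import Data.Empty using (⊥; ⊥-elim)
open import Data.Fin.Base as Fin using (Fin; toℕ)
open import Data.Integer.Base as ℤ using (ℤ; +_)
import Data.Integer.Properties as ℤ
open import Data.Nat.Base as ℕ using (ℕ; zero; suc; NonZero)
import Data.Nat.Properties as ℕ
open import Data.Product.Base using (Σ-syntax; ∃-syntax; _×_; _,_)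
open import Data.Rational.Base as ℚ using (ℚ; 0ℚ; 1ℚ; ½)
import Data.Rational.Properties as ℚ
open import Data.Rational.Solver using (module +-*-Solver)
import Data.Rational.Unnormalised.Base as ℚᵘ
import Data.Rational.Unnormalised.Properties as ℚᵘ
open import Data.Sum.Base using (_⊎_; inj₁; inj₂)
open import Function.Base using (_∘_)
open import Relation.Binary.PropositionalEquality
  using (_≡_; refl; sym; trans; cong; cong₂; subst; subst₂)

open import Algebra.Properties.AbelianGroup ℤ.+-0-abelianGroup using (∙-cancelʳ)
open Estimates
open Reciprocal
open +-*-Solver using (solve; con; _:=_)
  renaming (_:+_ to _⊕_; _:*_ to _⊗_; _:-_ to _⊝_; :-_ to ⊝_)
open RawSemiringOps ℚ.+-*-rawSemiring using () renaming (_^_ to _^ᵠ_; _×_ to _×ᵠ_)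

-- Rational inequalities

*-monoˡ : ∀ {r p q} → 0ℚ ℚ.≤ r → p ℚ.≤ q → r ℚ.* p ℚ.≤ r ℚ.* q
*-monoˡ {r} 0≤r = ℚ.*-monoˡ-≤-nonNeg r {{ℚ.nonNegative 0≤r}}

*-monoʳ : ∀ {r p q} → 0ℚ ℚ.≤ r → p ℚ.≤ q → p ℚ.* r ℚ.≤ q ℚ.* r
*-monoʳ {r} 0≤r = ℚ.*-monoʳ-≤-nonNeg r {{ℚ.nonNegative 0≤r}}

nonNeg-* : ∀ {p q} → 0ℚ ℚ.≤ p → 0ℚ ℚ.≤ q → 0ℚ ℚ.≤ p ℚ.* q
nonNeg-* {p} {q} 0≤p 0≤q = subst (ℚ._≤ p ℚ.* q) (ℚ.*-zeroʳ p) (*-monoˡ 0≤p 0≤q)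

nonNeg-^ : ∀ {p} → 0ℚ ℚ.≤ p → ∀ m → 0ℚ ℚ.≤ p ^ᵠ m
nonNeg-^ 0≤p zero    = ℚ.nonNegative⁻¹ 1ℚ
nonNeg-^ 0≤p (suc m) = nonNeg-* 0≤p (nonNeg-^ 0≤p m)

pos-^ : ∀ {p} → 0ℚ ℚ.< p → ∀ m → 0ℚ ℚ.< p ^ᵠ m
pos-^ 0<p zero    = ℚ.positive⁻¹ 1ℚ
pos-^ 0<p (suc m) = pos-* 0<p (pos-^ 0<p m)

∣p^m∣≡∣p∣^m : ∀ p m → ℚ.∣ p ^ᵠ m ∣ ≡ ℚ.∣ p ∣ ^ᵠ m
∣p^m∣≡∣p∣^m p zero    = refl
∣p^m∣≡∣p∣^m p (suc m) = trans (ℚ.∣p*q∣≡∣p∣*∣q∣ p (p ^ᵠ m)) (cong (ℚ.∣ p ∣ ℚ.*_) (∣p^m∣≡∣p∣^m p m))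

module _ {t δ s : ℚ} (0≤t : 0ℚ ℚ.≤ t) (0≤δ : 0ℚ ℚ.≤ δ) (t+δ≤s : t ℚ.+ δ ℚ.≤ s) where
  open ℚ.≤-Reasoning

  private
    t≤s : t ℚ.≤ s
    t≤s = ℚ.≤-trans (subst (ℚ._≤ t ℚ.+ δ) (ℚ.+-identityʳ t) (ℚ.+-monoʳ-≤ t 0≤δ)) t+δ≤s

    0≤s : 0ℚ ℚ.≤ s
    0≤s = ℚ.≤-trans 0≤t t≤s

  ^-mono : ∀ m → t ^ᵠ m ℚ.≤ s ^ᵠ m
  ^-mono zero    = ℚ.≤-refl
  ^-mono (suc m) = ℚ.≤-trans (*-monoˡ 0≤t (^-mono m)) (*-monoʳ (nonNeg-^ 0≤s m) t≤s)

  -- Expand `(t + δ) * (t ^ m + δ ^ m)` and drop the cross terms. Unlike `bernoulli`, this still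
  -- says something at `t = 0`.
  ^-superadditive : ∀ m → .{{NonZero m}} → t ^ᵠ m ℚ.+ δ ^ᵠ m ℚ.≤ s ^ᵠ m
  ^-superadditive (suc zero) = subst₂ ℚ._≤_
    (sym (cong₂ ℚ._+_ (ℚ.*-identityʳ t) (ℚ.*-identityʳ δ))) (sym (ℚ.*-identityʳ s)) t+δ≤s
  ^-superadditive (suc m@(suc _)) = begin
    t ℚ.* t ^ᵠ m ℚ.+ δ ℚ.* δ ^ᵠ m
      ≤⟨ ℚ.+-mono-≤ (*-monoˡ 0≤t (ℚ.≤-trans (ℚ.≤-reflexive (sym (ℚ.+-identityʳ _))) (ℚ.+-monoʳ-≤ (t ^ᵠ m) (nonNeg-^ 0≤δ m))))
                    (*-monoˡ 0≤δ (ℚ.≤-trans (ℚ.≤-reflexive (sym (ℚ.+-identityˡ _))) (ℚ.+-monoˡ-≤ (δ ^ᵠ m) (nonNeg-^ 0≤t m)))) ⟩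
    t ℚ.* (t ^ᵠ m ℚ.+ δ ^ᵠ m) ℚ.+ δ ℚ.* (t ^ᵠ m ℚ.+ δ ^ᵠ m)
      ≡⟨ ℚ.*-distribʳ-+ (t ^ᵠ m ℚ.+ δ ^ᵠ m) t δ ⟨
    (t ℚ.+ δ) ℚ.* (t ^ᵠ m ℚ.+ δ ^ᵠ m)
      ≤⟨ *-monoˡ (ℚ.+-mono-≤ 0≤t 0≤δ) (^-superadditive m) ⟩
    (t ℚ.+ δ) ℚ.* s ^ᵠ m
      ≤⟨ *-monoʳ (nonNeg-^ 0≤s m) t+δ≤s ⟩
    s ℚ.* s ^ᵠ m ∎

  -- Multiplied by t, so that no t ^ (m - 1) occurs.
  bernoulli : ∀ m → t ℚ.* t ^ᵠ m ℚ.+ (m ×ᵠ 1ℚ) ℚ.* δ ℚ.* t ^ᵠ m ℚ.≤ t ℚ.* s ^ᵠ m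
  bernoulli zero = ℚ.≤-reflexive
    (solve 2 (λ t δ → t ⊗ con 1ℚ ⊕ con 0ℚ ⊗ δ ⊗ con 1ℚ := t ⊗ con 1ℚ) refl t δ)
  bernoulli (suc m) = begin
    t ℚ.* (t ℚ.* t ^ᵠ m) ℚ.+ (1ℚ ℚ.+ m ×ᵠ 1ℚ) ℚ.* δ ℚ.* (t ℚ.* t ^ᵠ m)
      ≡⟨ solve 4 (λ t δ n p → t ⊗ (t ⊗ p) ⊕ (con 1ℚ ⊕ n) ⊗ δ ⊗ (t ⊗ p)
                            := t ⊗ (t ⊗ p ⊕ n ⊗ δ ⊗ p) ⊕ δ ⊗ t ⊗ p) refl t δ (m ×ᵠ 1ℚ) (t ^ᵠ m) ⟩
    t ℚ.* (t ℚ.* t ^ᵠ m ℚ.+ (m ×ᵠ 1ℚ) ℚ.* δ ℚ.* t ^ᵠ m) ℚ.+ δ ℚ.* t ℚ.* t ^ᵠ m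
      ≤⟨ ℚ.+-mono-≤ (*-monoˡ 0≤t (bernoulli m)) (*-monoˡ (nonNeg-* 0≤δ 0≤t) (^-mono m)) ⟩
    t ℚ.* (t ℚ.* s ^ᵠ m) ℚ.+ δ ℚ.* t ℚ.* s ^ᵠ m
      ≡⟨ solve 3 (λ t δ p → t ⊗ (t ⊗ p) ⊕ δ ⊗ t ⊗ p := t ⊗ ((t ⊕ δ) ⊗ p)) refl t δ (s ^ᵠ m) ⟩
    t ℚ.* ((t ℚ.+ δ) ℚ.* s ^ᵠ m)
      ≤⟨ *-monoˡ 0≤t (*-monoʳ (nonNeg-^ 0≤s m) t+δ≤s) ⟩
    t ℚ.* (s ℚ.* s ^ᵠ m) ∎

module _ {p q δ : ℚ} (0<δ : 0ℚ ℚ.< δ) (∣q∣+δ≤∣p∣ : ℚ.∣ q ∣ ℚ.+ δ ℚ.≤ ℚ.∣ p ∣) where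
  open ℚ.≤-Reasoning

  private
    ∣p∣^m-∣q∣^m≤∣p^m-q^m∣ : ∀ m → ℚ.∣ p ∣ ^ᵠ m ℚ.- ℚ.∣ q ∣ ^ᵠ m ℚ.≤ ℚ.∣ p ^ᵠ m ℚ.- q ^ᵠ m ∣
    ∣p∣^m-∣q∣^m≤∣p^m-q^m∣ m = subst₂ (λ u v → u ℚ.- v ℚ.≤ ℚ.∣ p ^ᵠ m ℚ.- q ^ᵠ m ∣)
      (∣p^m∣≡∣p∣^m p m) (∣p^m∣≡∣p∣^m q m) (∣p∣-∣q∣≤∣p-q∣ (p ^ᵠ m) (q ^ᵠ m))

  -- The bound depends on `δ` and `m` only, so it serves all late terms of two Cauchy sequences at
  -- once and keeps their difference of powers away from 0.
  δ^m≤∣p^m-q^m∣ : ∀ m → .{{NonZero m}} → δ ^ᵠ m ℚ.≤ ℚ.∣ p ^ᵠ m ℚ.- q ^ᵠ m ∣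
  δ^m≤∣p^m-q^m∣ m = begin
    δ ^ᵠ m
      ≡⟨ solve 2 (λ d t → d := (t ⊕ d) ⊝ t) refl (δ ^ᵠ m) (ℚ.∣ q ∣ ^ᵠ m) ⟩
    (ℚ.∣ q ∣ ^ᵠ m ℚ.+ δ ^ᵠ m) ℚ.- ℚ.∣ q ∣ ^ᵠ m
      ≤⟨ ℚ.+-monoˡ-≤ _ (^-superadditive (ℚ.0≤∣p∣ q) (ℚ.<⇒≤ 0<δ) ∣q∣+δ≤∣p∣ m) ⟩
    ℚ.∣ p ∣ ^ᵠ m ℚ.- ℚ.∣ q ∣ ^ᵠ m
      ≤⟨ ∣p∣^m-∣q∣^m≤∣p^m-q^m∣ m ⟩
    ℚ.∣ p ^ᵠ m ℚ.- q ^ᵠ m ∣ ∎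

  -- With `r` the reciprocal of `p ^ m - q ^ m`, the factor `(p - q) * r` is `1 / U m` by Binet's
  -- formula. Multiplying the Bernoulli bound by `∣ p - q ∣ * ∣ r ∣` cancels the difference of
  -- powers.
  quotient-decay : ∀ m {r} → (p ^ᵠ m ℚ.- q ^ᵠ m) ℚ.* r ≡ 1ℚ →
    (m ×ᵠ 1ℚ) ℚ.* δ ℚ.* ℚ.∣ q ^ᵠ m ℚ.* ((p ℚ.- q) ℚ.* r) ∣ ℚ.≤ ℚ.∣ (p ℚ.- q) ℚ.* q ∣
  quotient-decay m {r} wr≡1 = begin
    n ℚ.* δ ℚ.* ℚ.∣ q ^ᵠ m ℚ.* (d ℚ.* r) ∣
      ≡⟨ cong (n ℚ.* δ ℚ.*_) (trans (ℚ.∣p*q∣≡∣p∣*∣q∣ (q ^ᵠ m) (d ℚ.* r))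
           (cong₂ ℚ._*_ (∣p^m∣≡∣p∣^m q m) (ℚ.∣p*q∣≡∣p∣*∣q∣ d r))) ⟩
    n ℚ.* δ ℚ.* (t ^ᵠ m ℚ.* (ℚ.∣ d ∣ ℚ.* ℚ.∣ r ∣))
      ≡⟨ ℚ.*-assoc (n ℚ.* δ) (t ^ᵠ m) _ ⟨
    n ℚ.* δ ℚ.* t ^ᵠ m ℚ.* (ℚ.∣ d ∣ ℚ.* ℚ.∣ r ∣)
      ≤⟨ *-monoʳ (nonNeg-* (ℚ.0≤∣p∣ d) (ℚ.0≤∣p∣ r)) nδt^m≤tw ⟩
    t ℚ.* ℚ.∣ w ∣ ℚ.* (ℚ.∣ d ∣ ℚ.* ℚ.∣ r ∣)
      ≡⟨ solve 4 (λ t w d r → t ⊗ w ⊗ (d ⊗ r) := d ⊗ t ⊗ (w ⊗ r)) refl t ℚ.∣ w ∣ ℚ.∣ d ∣ ℚ.∣ r ∣ ⟩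
    ℚ.∣ d ∣ ℚ.* t ℚ.* (ℚ.∣ w ∣ ℚ.* ℚ.∣ r ∣)
      ≡⟨ cong₂ ℚ._*_ (sym (ℚ.∣p*q∣≡∣p∣*∣q∣ d q))
           (trans (sym (ℚ.∣p*q∣≡∣p∣*∣q∣ w r)) (cong ℚ.∣_∣ wr≡1)) ⟩
    ℚ.∣ d ℚ.* q ∣ ℚ.* 1ℚ
      ≡⟨ ℚ.*-identityʳ _ ⟩
    ℚ.∣ d ℚ.* q ∣ ∎
    where
    n t d w : ℚ
    n = m ×ᵠ 1ℚ
    t = ℚ.∣ q ∣
    d = p ℚ.- q
    w = p ^ᵠ m ℚ.- q ^ᵠ m

    nδt^m≤tw : n ℚ.* δ ℚ.* t ^ᵠ m ℚ.≤ t ℚ.* ℚ.∣ w ∣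
    nδt^m≤tw = begin
      n ℚ.* δ ℚ.* t ^ᵠ m
        ≡⟨ solve 2 (λ x y → x := (y ⊕ x) ⊝ y) refl (n ℚ.* δ ℚ.* t ^ᵠ m) (t ℚ.* t ^ᵠ m) ⟩
      (t ℚ.* t ^ᵠ m ℚ.+ n ℚ.* δ ℚ.* t ^ᵠ m) ℚ.- t ℚ.* t ^ᵠ m
        ≤⟨ ℚ.+-monoˡ-≤ _ (bernoulli (ℚ.0≤∣p∣ q) (ℚ.<⇒≤ 0<δ) ∣q∣+δ≤∣p∣ m) ⟩
      t ℚ.* ℚ.∣ p ∣ ^ᵠ m ℚ.- t ℚ.* t ^ᵠ m
        ≡⟨ solve 3 (λ t x y → t ⊗ x ⊝ t ⊗ y := t ⊗ (x ⊝ y)) refl t (ℚ.∣ p ∣ ^ᵠ m) (t ^ᵠ m) ⟩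
      t ℚ.* (ℚ.∣ p ∣ ^ᵠ m ℚ.- t ^ᵠ m)
        ≤⟨ *-monoˡ (ℚ.0≤∣p∣ q) (∣p∣^m-∣q∣^m≤∣p^m-q^m∣ m) ⟩
      t ℚ.* ℚ.∣ w ∣ ∎

-- The Archimedean property of the rationals

toℚᵘ-× : ∀ m → ℚ.toℚᵘ (m ×ᵠ 1ℚ) ℚᵘ.≃ ℚᵘ.mkℚᵘ (+ m) 0
toℚᵘ-× zero    = ℚᵘ.≃-refl
toℚᵘ-× (suc m) = ℚᵘ.≃-trans (ℚ.toℚᵘ-homo-+ 1ℚ (m ×ᵠ 1ℚ))
  (ℚᵘ.≃-trans (ℚᵘ.+-congʳ ℚᵘ.1ℚᵘ (toℚᵘ-× m))
    (ℚᵘ.*≡* (cong (ℤ._* + 1) (cong (λ i → + 1 ℤ.+ i) (ℤ.*-identityʳ (+ m))))))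

i≤+∣i∣ : ∀ i → i ℤ.≤ + ℤ.∣ i ∣
i≤+∣i∣ (+ n)      = ℤ.≤-refl
i≤+∣i∣ ℤ.-[1+ n ] = ℤ.-≤+

-- A denominator is at least 1, so a rational never exceeds the absolute value of its numerator.
p≤m×1 : ∀ p {m} → ℤ.∣ ℚ.↥ p ∣ ℕ.≤ m → p ℚ.≤ m ×ᵠ 1ℚ
p≤m×1 p@(ℚ.mkℚ i d _) {m} ∣i∣≤m = ℚ.toℚᵘ-cancel-≤ (ℚᵘ.≤-trans (ℚᵘ.*≤* (begin
  i ℤ.* + 1        ≡⟨ ℤ.*-identityʳ i ⟩
  i                ≤⟨ i≤+∣i∣ i ⟩
  + ℤ.∣ i ∣        ≤⟨ ℤ.+≤+ (ℕ.≤-trans ∣i∣≤m (ℕ.m≤m*n m (suc d))) ⟩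
  + (m ℕ.* suc d)  ≡⟨ ℤ.pos-* m (suc d) ⟩
  + m ℤ.* + suc d  ∎)) (ℚᵘ.≤-reflexive (ℚᵘ.≃-sym (toℚᵘ-× m))))
  where open ℤ.≤-Reasoning

archimedean : ∀ {δ} C → 0ℚ ℚ.< C → 0ℚ ℚ.< δ →
  ∃[ M ] (∀ m → M ℕ.≤ m → C ℚ.≤ (m ×ᵠ 1ℚ) ℚ.* δ)
archimedean {δ} C 0<C 0<δ =
  -- `η` is `C / δ`.
  let η , _ , δη≡C = rescale 0<δ 0<C in
  ℤ.∣ ℚ.↥ η ∣ , λ m M≤m → subst (ℚ._≤ (m ×ᵠ 1ℚ) ℚ.* δ)
    (trans (ℚ.*-comm η δ) δη≡C) (*-monoʳ (ℚ.<⇒≤ 0<δ) (p≤m×1 η M≤m))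

-- Properties that hold from some index on

Eventually : (ℕ → Set) → Set
Eventually A = ∃[ N ] (∀ n → N ℕ.≤ n → A n)

ev-map : ∀ {A B : ℕ → Set} → (∀ n → A n → B n) → Eventually A → Eventually B
ev-map f (N , h) = N , λ n N≤n → f n (h n N≤n)

ev-zip : ∀ {A B C : ℕ → Set} → (∀ n → A n → B n → C n) →
         Eventually A → Eventually B → Eventually C
ev-zip f (M , g) (N , h) = M ℕ.⊔ N , λ n MN≤n →
  f n (g n (ℕ.m⊔n≤o⇒m≤o M N MN≤n)) (h n (ℕ.m⊔n≤o⇒n≤o M N MN≤n))

-- Equality of reals

infix 4 _≃_

-- _≈_ unfolds to a statement about seq, from which unification cannot
-- recover the Cauchy moduli of the two reals; the record keeps them visible.
record _≃_ (x y : ℝ) : Set where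
  constructor ⟪_⟫
  field ≃⇒≈ : x ≈ y

≃-refl : ∀ {x} → x ≃ x
≃-refl {x} = ⟪ (λ ε 0<ε → 0 , λ n _ →
  subst (λ p → ℚ.∣ p ∣ ℚ.< ε) (sym (ℚ.+-inverseʳ (seq x n))) 0<ε) ⟫

0<½* : ∀ {ε} → 0ℚ ℚ.< ε → 0ℚ ℚ.< ε ℚ.* ½
0<½* 0<ε = pos-* 0<ε (ℚ.positive⁻¹ ½)

-- All equations between reals are derived as linear combinations
-- x - y = Σ cᵢ (lᵢ - rᵢ) of known equations lᵢ ≃ rᵢ, verified termwise in ℚ.

infixr 6 _∙_
infixr 5 _⊞_

_∙_ : ∀ c {l r} → l ≃ r → c * (l - r) ≃ 0ℝ
_∙_ c {l} {r} ⟪ l≈r ⟫ = ⟪ (λ ε 0<ε →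
  let B , 0<B , ∣c∣<B = eventually-bounded c
      δ , 0<δ , Bδ≡ε  = rescale 0<B 0<ε
  in ev-zip
       (λ n c<B l-r<δ → subst₂ ℚ._<_ (cong ℚ.∣_∣ (sym (ℚ.+-identityʳ _))) Bδ≡ε
         (*-∣∣-< (seq c n) (seq l n ℚ.- seq r n) 0<δ c<B l-r<δ))
       ∣c∣<B (l≈r δ 0<δ)) ⟫

_⊞_ : ∀ {x y} → x ≃ 0ℝ → y ≃ 0ℝ → x + y ≃ 0ℝ
_⊞_ {x} {y} ⟪ x≈0 ⟫ ⟪ y≈0 ⟫ = ⟪ (λ ε 0<ε → ev-zip
  (λ n x< y< → subst (ℚ.∣ (seq x n ℚ.+ seq y n) ℚ.- 0ℚ ∣ ℚ.<_) (half+half ε)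
    (+-estimate (seq x n) (seq y n) 0ℚ 0ℚ x< y<))
  (x≈0 (ε ℚ.* ½) (0<½* 0<ε)) (y≈0 (ε ℚ.* ½) (0<½* 0<ε))) ⟫

linear-combination : ∀ {x y z} → z ≃ 0ℝ →
  (∀ n → seq x n ℚ.- seq y n ≡ seq z n) → x ≃ y
linear-combination {x} {y} {z} ⟪ z≈0 ⟫ x-y≗z = ⟪ (λ ε 0<ε → ev-map
  (λ n → subst (λ p → ℚ.∣ p ∣ ℚ.< ε) (trans (ℚ.+-identityʳ (seq z n)) (sym (x-y≗z n))))
  (z≈0 ε 0<ε)) ⟫

seq-^ : ∀ x m n → seq (x ^ m) n ≡ seq x n ^ᵠ m
seq-^ x zero    n = refl
seq-^ x (suc m) n = cong (seq x n ℚ.*_) (seq-^ x m n)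

-- Apartness

-- Once the terms lie within `c` of one another, terms of opposite sign would be too far apart, so
-- the sign of the term at `J` is that of the whole tail.
bounded-below⇒apart : ∀ x {c} → 0ℚ ℚ.< c → Eventually (λ n → c ℚ.≤ ℚ.∣ seq x n ∣) → x # 0ℝ
bounded-below⇒apart x {c} 0<c (K , c≤∣x∣) with cauchy x c 0<c
... | N , x-x<c = sign-of-tail (ℚ.≤-total 0ℚ (seq x J))
  where
  J = K ℕ.⊔ N

  opposite-far : ∀ {p q} → c ℚ.≤ p → 0ℚ ℚ.≤ ℚ.- q → ℚ.∣ p ℚ.- q ∣ ℚ.< c → ⊥
  opposite-far {p} {q} c≤p 0≤-q p-q<c = ℚ.<-irrefl refl (ℚ.≤-<-trans
    (subst (ℚ._≤ p ℚ.- q) (ℚ.+-identityʳ c) (ℚ.+-mono-≤ c≤p 0≤-q))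
    (ℚ.≤-<-trans (p≤∣p∣ (p ℚ.- q)) p-q<c))

  close : ∀ n → J ℕ.≤ n → ℚ.∣ seq x J ℚ.- seq x n ∣ ℚ.< c
  close n J≤n = x-x<c J n (ℕ.m≤n⊔m K N) (ℕ.m⊔n≤o⇒n≤o K N J≤n)

  far : ∀ n → J ℕ.≤ n → c ℚ.≤ ℚ.∣ seq x n ∣
  far n J≤n = c≤∣x∣ n (ℕ.m⊔n≤o⇒m≤o K N J≤n)

  neg⇒∣p∣ : ∀ {p} → p ℚ.≤ 0ℚ → ℚ.∣ p ∣ ≡ ℚ.- p
  neg⇒∣p∣ {p} p≤0 = trans (sym (ℚ.∣-p∣≡∣p∣ p)) (ℚ.0≤p⇒∣p∣≡p (ℚ.neg-antimono-≤ p≤0))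

  sign-of-tail : 0ℚ ℚ.≤ seq x J ⊎ seq x J ℚ.≤ 0ℚ → x # 0ℝ
  sign-of-tail (inj₁ 0≤xJ) = inj₂ (c , 0<c , J , λ n J≤n →
    subst (ℚ._≤ seq x n) (sym (ℚ.+-identityˡ c)) (pos-tail n J≤n (ℚ.≤-total 0ℚ (seq x n))))
    where
    pos-tail : ∀ n → J ℕ.≤ n → 0ℚ ℚ.≤ seq x n ⊎ seq x n ℚ.≤ 0ℚ → c ℚ.≤ seq x n
    pos-tail n J≤n (inj₁ 0≤xn) = subst (c ℚ.≤_) (ℚ.0≤p⇒∣p∣≡p 0≤xn) (far n J≤n)
    pos-tail n J≤n (inj₂ xn≤0) = ⊥-elim (opposite-far
      (subst (c ℚ.≤_) (ℚ.0≤p⇒∣p∣≡p 0≤xJ) (far J ℕ.≤-refl)) (ℚ.neg-antimono-≤ xn≤0) (close n J≤n))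
  sign-of-tail (inj₂ xJ≤0) = inj₁ (c , 0<c , J , λ n J≤n →
    subst₂ ℚ._≤_ (ℚ.+-comm c (seq x n)) (ℚ.+-inverseˡ (seq x n))
      (ℚ.+-monoˡ-≤ (seq x n) (neg-tail n J≤n (ℚ.≤-total 0ℚ (seq x n)))))
    where
    neg-tail : ∀ n → J ℕ.≤ n → 0ℚ ℚ.≤ seq x n ⊎ seq x n ℚ.≤ 0ℚ → c ℚ.≤ ℚ.- seq x n
    neg-tail n J≤n (inj₂ xn≤0) = subst (c ℚ.≤_) (neg⇒∣p∣ xn≤0) (far n J≤n)
    -- Negating both terms gives the signs that `opposite-far` expects and keeps their distance.
    neg-tail n J≤n (inj₁ 0≤xn) = ⊥-elim (opposite-far
      (subst (c ℚ.≤_) (neg⇒∣p∣ xJ≤0) (far J ℕ.≤-refl))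
      (subst (0ℚ ℚ.≤_) (solve 1 (λ q → q := ⊝ (⊝ q)) refl (seq x n)) 0≤xn)
      (subst (ℚ._< c) (trans (∣p-q∣≡∣q-p∣ (seq x J) (seq x n))
        (cong ℚ.∣_∣ (solve 2 (λ p q → q ⊝ p := (⊝ p) ⊝ (⊝ q)) refl (seq x J) (seq x n)))) (close n J≤n)))

*-inv : ∀ x (x#0 : x # 0ℝ) → x * inv x x#0 ≃ 1ℝ
*-inv x x#0 =
  let c , 0<c , c≤∣x∣ = apart⇒bounded-below {x} x#0 in
  ⟪ (λ ε 0<ε → ev-map
    (λ n c≤ → subst (ℚ._< ε) (sym (cong (λ p → ℚ.∣ p ℚ.- 1ℚ ∣) (*-recip (seq x n) 0<c c≤))) 0<ε)
    c≤∣x∣) ⟫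

-- If `∣ y ∣ < B` and `∣ x * y - 1 ∣ < ½`, then `∣ x ∣` is at least `c = 1 / (2 B)`: otherwise
-- `1 ≤ ∣ 1 - x * y ∣ + ∣ x * y ∣ < 1`.
invertible⇒apart : ∀ x y → x * y ≃ 1ℝ → x # 0ℝ
invertible⇒apart x y ⟪ xy≈1 ⟫ =
  let B , 0<B , ∣y∣<B = eventually-bounded y
      c , 0<c , Bc≡½  = rescale 0<B 0<½
  in bounded-below⇒apart x 0<c (ev-zip
    (λ n y<B xy-1<½ → ℚ.≮⇒≥ λ x<c → ℚ.<-irrefl refl (begin-strict
      1ℚ
        ≤⟨ ∣p∣≤∣p-q∣+∣q∣ 1ℚ (seq x n ℚ.* seq y n) ⟩
      ℚ.∣ 1ℚ ℚ.- seq x n ℚ.* seq y n ∣ ℚ.+ ℚ.∣ seq x n ℚ.* seq y n ∣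
        <⟨ ℚ.+-mono-<
             (subst (ℚ._< ½) (∣p-q∣≡∣q-p∣ (seq x n ℚ.* seq y n) 1ℚ) xy-1<½)
             (subst₂ ℚ._<_ (cong ℚ.∣_∣ (ℚ.*-comm (seq y n) (seq x n))) Bc≡½
               (*-∣∣-< (seq y n) (seq x n) 0<c y<B x<c)) ⟩
      ½ ℚ.+ ½
        ≡⟨⟩
      1ℚ ∎))
    ∣y∣<B (xy≈1 ½ 0<½))
  where
  open ℚ.≤-Reasoning
  0<½ : 0ℚ ℚ.< ½
  0<½ = ℚ.positive⁻¹ ½

-- Null sequences

-- Rational bounds on late terms of the representatives keep all estimates inside ℚ; `null⇒⟶` passes
-- to a real `ε` at the end.
Null : (ℕ → ℝ) → Set
Null s = ∀ ε → 0ℚ ℚ.< ε → Eventually λ n → Eventually λ j → ℚ.∣ seq (s n) j ∣ ℚ.< ε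

small-resp-≃ : ∀ {x y ε} → x ≃ y → 0ℚ ℚ.< ε →
  Eventually (λ n → ℚ.∣ seq x n ∣ ℚ.< ε ℚ.* ½) → Eventually (λ n → ℚ.∣ seq y n ∣ ℚ.< ε)
small-resp-≃ {x} {y} {ε} ⟪ x≈y ⟫ 0<ε = ev-zip
  (λ n x-y< x< → ℚ.≤-<-trans (∣p∣≤∣p-q∣+∣q∣ (seq y n) (seq x n))
    (subst (ℚ.∣ seq y n ℚ.- seq x n ∣ ℚ.+ ℚ.∣ seq x n ∣ ℚ.<_) (half+half ε)
      (ℚ.+-mono-< (subst (ℚ._< ε ℚ.* ½) (∣p-q∣≡∣q-p∣ (seq x n) (seq y n)) x-y<) x<)))
  (x≈y (ε ℚ.* ½) (0<½* 0<ε))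

null-resp-≃ : ∀ {s t} → (∀ n → s n ≃ t n) → Null s → Null t
null-resp-≃ {s} {t} s≃t s-null ε 0<ε =
  ev-map (λ n → small-resp-≃ {s n} {t n} (s≃t n) 0<ε) (s-null (ε ℚ.* ½) (0<½* 0<ε))

null-+ : ∀ {s t} → Null s → Null t → Null (λ n → s n + t n)
null-+ {s} {t} s-null t-null ε 0<ε = ev-zip
  (λ n → ev-zip (λ j s< t< → ℚ.≤-<-trans (ℚ.∣p+q∣≤∣p∣+∣q∣ (seq (s n) j) (seq (t n) j))
    (subst (_ ℚ.<_) (half+half ε) (ℚ.+-mono-< s< t<))))
  (s-null (ε ℚ.* ½) (0<½* 0<ε)) (t-null (ε ℚ.* ½) (0<½* 0<ε))

null-neg : ∀ {s} → Null s → Null (λ n → - s n)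
null-neg {s} s-null ε 0<ε = ev-map
  (λ n → ev-map (λ j → subst (ℚ._< ε) (sym (ℚ.∣-p∣≡∣p∣ (seq (s n) j)))))
  (s-null ε 0<ε)

null-sum : ∀ k {s : Fin k → ℕ → ℝ} → (∀ i → Null (s i)) → Null (λ n → sum (λ i → s i n))
null-sum zero    s-null ε 0<ε = 0 , λ _ _ → 0 , λ _ _ → 0<ε
null-sum (suc k) {s} s-null = null-+ {s Fin.zero} {λ n → sum (λ i → s (Fin.suc i) n)}
  (s-null Fin.zero) (null-sum k {λ i → s (Fin.suc i)} (λ i → s-null (Fin.suc i)))

null-shift : ∀ {s} → Null s → ∀ i → Null (λ n → s (n ℕ.+ i))
null-shift {s} s-null i ε 0<ε with s-null ε 0<ε
... | N , h = N , λ n N≤n → h (n ℕ.+ i) (ℕ.≤-trans N≤n (ℕ.m≤m+n n i))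

null⇒⟶ : ∀ {s l} → Null (λ n → s n - l) → s ⟶ l
null⇒⟶ {s} {l} s-l-null ε (δ , 0<δ , δ≤ε) = ev-map
  -- The rational `δ` witnesses `0ℝ < ε`. One half of it bounds the error, the other half is the
  -- margin required by `_<_` on reals.
  (λ n s-l< → δ ℚ.* ½ , 0<½* 0<δ , ev-zip
    (λ j s-l<½δ 0+δ≤ε → begin
      ℚ.∣ seq (s n) j ℚ.- seq l j ∣ ℚ.+ δ ℚ.* ½  ≤⟨ ℚ.+-monoˡ-≤ (δ ℚ.* ½) (ℚ.<⇒≤ s-l<½δ) ⟩
      δ ℚ.* ½ ℚ.+ δ ℚ.* ½                       ≡⟨ half+half δ ⟩
      δ                                         ≡⟨ ℚ.+-identityˡ δ ⟨
      0ℚ ℚ.+ δ                                  ≤⟨ 0+δ≤ε ⟩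
      seq ε j                                   ∎)
    s-l< δ≤ε)
  (s-l-null (δ ℚ.* ½) (0<½* 0<δ))
  where open ℚ.≤-Reasoning

-- Telescoping sums

-- `sum` unfolds at its first summand only, so the term gained at the far end of the window has to
-- be reached by induction.
sum-drop-head : ∀ k (b : ℕ → ℝ) → sum {k} (b ∘ suc ∘ toℕ) + b 0 ≃ sum {k} (b ∘ toℕ) + b k
sum-drop-head zero    b = ⟪ (λ ε 0<ε → 0 , λ n _ →
  subst (λ p → ℚ.∣ p ∣ ℚ.< ε) (sym (ℚ.+-inverseʳ (0ℚ ℚ.+ seq (b 0) n))) 0<ε) ⟫
sum-drop-head (suc k) b = linear-combination (1ℝ ∙ sum-drop-head k (b ∘ suc))
  λ n → solve 5 (λ b₀ b₁ bₖ s t → (b₁ ⊕ s ⊕ b₀) ⊝ (b₀ ⊕ t ⊕ bₖ) := con 1ℚ ⊗ ((s ⊕ b₁) ⊝ (t ⊕ bₖ))) refl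
    (seq (b 0) n) (seq (b 1) n) (seq (b (suc k)) n)
    (seq (sum {k} (b ∘ suc ∘ suc ∘ toℕ)) n) (seq (sum {k} (b ∘ suc ∘ toℕ)) n)

sum-telescope : ∀ m k (b c d : ℕ → ℝ) →
  (∀ i → d i ≃ b i - c i) → (∀ i → c i ≡ b (i ℕ.+ k)) →
  sum {m} (d ∘ toℕ) + sum {k} (λ i → b (m ℕ.+ toℕ i)) ≃ sum {k} (b ∘ toℕ)
sum-telescope zero    k b c d d≃b-c c≡b = ⟪ (λ ε 0<ε → 0 , λ n _ →
  subst (λ p → ℚ.∣ p ∣ ℚ.< ε)
    (solve 1 (λ s → con 0ℚ := con 0ℚ ⊕ s ⊝ s) refl (seq (sum {k} (b ∘ toℕ)) n)) 0<ε) ⟫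
-- The induction hypothesis for the shifted sequences yields the window from `b 1` to `b k`; adding
-- `d 0 = b 0 - b k` moves it back by one place.
sum-telescope (suc m) k b c d d≃b-c c≡b = linear-combination
  (1ℝ ∙ subst (λ x → d 0 ≃ b 0 - x) (c≡b 0) (d≃b-c 0)
   ⊞ 1ℝ ∙ sum-telescope m k (λ i → b (suc i)) (λ i → c (suc i)) (λ i → d (suc i))
             (λ i → d≃b-c (suc i)) (λ i → c≡b (suc i))
   ⊞ 1ℝ ∙ sum-drop-head k b)
  λ n → solve 7 (λ d₀ b₀ bₖ s t u v → (d₀ ⊕ s ⊕ t) ⊝ v
                   := con 1ℚ ⊗ (d₀ ⊝ (b₀ ⊝ bₖ))
                    ⊕ (con 1ℚ ⊗ (s ⊕ t ⊝ u) ⊕ con 1ℚ ⊗ ((u ⊕ b₀) ⊝ (v ⊕ bₖ)))) refl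
    (seq (d 0) n) (seq (b 0) n) (seq (b k) n)
    (seq (sum {m} (d ∘ suc ∘ toℕ)) n) (seq (sum {k} (λ i → b (suc (m ℕ.+ toℕ i)))) n)
    (seq (sum {k} (b ∘ suc ∘ toℕ)) n) (seq (sum {k} (b ∘ toℕ)) n)

-- Lucas sequences

-- `δ` and `gap` unpack `∣ β ∣ < ∣ α ∣`, so that the rational estimates apply to every late term
-- with the same `δ`.
module DominantRoot (P Q α β : ℝ)
  (α-root : α ^ 2 - P * α + Q ≃ 0ℝ) (β-root : β ^ 2 - P * β + Q ≃ 0ℝ)
  {δ : ℚ} (0<δ : 0ℚ ℚ.< δ) (gap : Eventually λ n → ℚ.∣ seq β n ∣ ℚ.+ δ ℚ.≤ ℚ.∣ seq α n ∣)
  where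

  α^m-β^m#0 : ∀ m → .{{NonZero m}} → α ^ m - β ^ m # 0ℝ
  α^m-β^m#0 m = bounded-below⇒apart (α ^ m - β ^ m) (pos-^ 0<δ m) (ev-map (λ n gapₙ →
    subst₂ (λ p q → δ ^ᵠ m ℚ.≤ ℚ.∣ p ℚ.- q ∣) (sym (seq-^ α m n)) (sym (seq-^ β m n))
      (δ^m≤∣p^m-q^m∣ 0<δ gapₙ m)) gap)

  α-β#0 : α - β # 0ℝ
  α-β#0 = bounded-below⇒apart (α - β) 0<δ (ev-map (λ n gapₙ → ℚ.≤-trans
    (subst (ℚ._≤ ℚ.∣ seq α n ∣ ℚ.- ℚ.∣ seq β n ∣)
      (solve 2 (λ t d → t ⊕ d ⊝ t := d) refl ℚ.∣ seq β n ∣ δ)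
      (ℚ.+-monoˡ-≤ (ℚ.- ℚ.∣ seq β n ∣) gapₙ))
    (∣p∣-∣q∣≤∣p-q∣ (seq α n) (seq β n))) gap)

  -- Subtracting the root equations gives `(α - β) * (α + β - P) = 0`, and `α - β` is invertible.
  α+β≃P : α + β ≃ P
  α+β≃P = linear-combination
    (I ∙ α-root ⊞ - I ∙ β-root ⊞ - (α + β - P) ∙ *-inv (α - β) α-β#0)
    λ n → solve 5 (λ P Q α β I → (α ⊕ β) ⊝ P
      := I ⊗ ((α ⊗ (α ⊗ con 1ℚ) ⊝ P ⊗ α ⊕ Q) ⊝ con 0ℚ)
       ⊕ ((⊝ I) ⊗ ((β ⊗ (β ⊗ con 1ℚ) ⊝ P ⊗ β ⊕ Q) ⊝ con 0ℚ)
       ⊕ (⊝ (α ⊕ β ⊝ P)) ⊗ ((α ⊝ β) ⊗ I ⊝ con 1ℚ))) refl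
      (seq P n) (seq Q n) (seq α n) (seq β n) (seq I n)
    where I = inv (α - β) α-β#0

  αβ≃Q : α * β ≃ Q
  αβ≃Q = linear-combination (α ∙ α+β≃P ⊞ - 1ℝ ∙ α-root)
    λ n → solve 4 (λ P Q α β → α ⊗ β ⊝ Q
      := α ⊗ ((α ⊕ β) ⊝ P) ⊕ (⊝ con 1ℚ) ⊗ ((α ⊗ (α ⊗ con 1ℚ) ⊝ P ⊗ α ⊕ Q) ⊝ con 0ℚ)) refl
      (seq P n) (seq Q n) (seq α n) (seq β n)

  module Lucas (U : ℤ → ℝ) (U₀ : U (+ 0) ≃ 0ℝ) (U₁ : U (+ 1) ≃ 1ℝ)
    (U-rec : ∀ i → U (i ℤ.+ + 2) ≃ P * U (i ℤ.+ + 1) - Q * U i)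
    where

    U-rec-at : ∀ i {j l} → i ℤ.+ + 1 ≡ j → i ℤ.+ + 2 ≡ l → U l ≃ P * U j - Q * U i
    U-rec-at i refl refl = U-rec i

    U-rec-ℕ : ∀ m → U (+ suc (suc m)) ≃ P * U (+ suc m) - Q * U (+ m)
    U-rec-ℕ m = U-rec-at (+ m) (cong +_ (ℕ.+-comm m 1)) (cong +_ (ℕ.+-comm m 2))

    -- By Vieta the recurrence reads `U (m + 2) - α U (m + 1) = β (U (m + 1) - α U m)`, so this
    -- difference starts at 1 and gains a factor `β` at each step.
    U-step : ∀ m → U (+ suc m) ≃ α * U (+ m) + β ^ m
    U-step zero = linear-combination (1ℝ ∙ U₁ ⊞ - α ∙ U₀)
      λ n → solve 3 (λ α u₀ u₁ → u₁ ⊝ (α ⊗ u₀ ⊕ con 1ℚ)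
        := con 1ℚ ⊗ (u₁ ⊝ con 1ℚ) ⊕ (⊝ α) ⊗ (u₀ ⊝ con 0ℚ)) refl
        (seq α n) (seq (U (+ 0)) n) (seq (U (+ 1)) n)
    U-step (suc m) = linear-combination
      (1ℝ ∙ U-rec-ℕ m ⊞ β ∙ U-step m ⊞ - U (+ suc m) ∙ α+β≃P ⊞ U (+ m) ∙ αβ≃Q)
      λ n → solve 8 (λ P Q α β B u₀ u₁ u₂ → u₂ ⊝ (α ⊗ u₁ ⊕ β ⊗ B)
        := con 1ℚ ⊗ (u₂ ⊝ (P ⊗ u₁ ⊝ Q ⊗ u₀))
         ⊕ (β ⊗ (u₁ ⊝ (α ⊗ u₀ ⊕ B))
         ⊕ ((⊝ u₁) ⊗ ((α ⊕ β) ⊝ P)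
         ⊕ u₀ ⊗ (α ⊗ β ⊝ Q)))) refl
        (seq P n) (seq Q n) (seq α n) (seq β n) (seq (β ^ m) n)
        (seq (U (+ m)) n) (seq (U (+ suc m)) n) (seq (U (+ suc (suc m))) n)

    binet : ∀ m → (α - β) * U (+ m) ≃ α ^ m - β ^ m
    binet zero = linear-combination ((α - β) ∙ U₀)
      λ n → solve 3 (λ α β u₀ → (α ⊝ β) ⊗ u₀ ⊝ (con 1ℚ ⊝ con 1ℚ)
        := (α ⊝ β) ⊗ (u₀ ⊝ con 0ℚ)) refl (seq α n) (seq β n) (seq (U (+ 0)) n)
    binet (suc m) = linear-combination ((α - β) ∙ U-step m ⊞ α ∙ binet m)
      λ n → solve 6 (λ α β A B u₀ u₁ → (α ⊝ β) ⊗ u₁ ⊝ (α ⊗ A ⊝ β ⊗ B)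
        := (α ⊝ β) ⊗ (u₁ ⊝ (α ⊗ u₀ ⊕ B)) ⊕ α ⊗ ((α ⊝ β) ⊗ u₀ ⊝ (A ⊝ B))) refl
        (seq α n) (seq β n) (seq (α ^ m) n) (seq (β ^ m) n)
        (seq (U (+ m)) n) (seq (U (+ suc m)) n)

    U-cong : ∀ {i j} → i ≡ j → U i ≃ U j
    U-cong refl = ≃-refl

    -- The second base case of the induction in `Q^m*U-difference`. For `l = 0` the index is -1 and
    -- the recurrence is run backwards; otherwise `U-step` is multiplied by `β` and `α β = Q` is
    -- used.
    Q*U-pred : ∀ l i → i ℤ.+ + 1 ≡ + l → Q * U i ≃ β * U (+ l) - β ^ l
    Q*U-pred zero i i+1≡0 = linear-combination
      (1ℝ ∙ U-rec-at i i+1≡0 i+2≡1 ⊞ (P - β) ∙ U₀ ⊞ - 1ℝ ∙ U₁)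
      λ n → solve 6 (λ P Q β u₋₁ u₀ u₁ →
          Q ⊗ u₋₁ ⊝ (β ⊗ u₀ ⊝ con 1ℚ)
        := con 1ℚ ⊗ (u₁ ⊝ (P ⊗ u₀ ⊝ Q ⊗ u₋₁))
         ⊕ ((P ⊝ β) ⊗ (u₀ ⊝ con 0ℚ) ⊕ (⊝ con 1ℚ) ⊗ (u₁ ⊝ con 1ℚ))) refl
        (seq P n) (seq Q n) (seq β n) (seq (U i) n) (seq (U (+ 0)) n) (seq (U (+ 1)) n)
      where
      i+2≡1 : i ℤ.+ + 2 ≡ + 1
      i+2≡1 = trans (sym (ℤ.+-assoc i (+ 1) (+ 1))) (cong (λ j → j ℤ.+ + 1) i+1≡0)
    Q*U-pred (suc l) i i+1≡l = linear-combination
      (- β ∙ U-step l ⊞ - U (+ l) ∙ αβ≃Q ⊞ Q ∙ U-cong i≡l)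
      λ n → solve 7 (λ Q α β B u u′ v → Q ⊗ v ⊝ (β ⊗ u′ ⊝ β ⊗ B)
        := (⊝ β) ⊗ (u′ ⊝ (α ⊗ u ⊕ B)) ⊕ ((⊝ u) ⊗ (α ⊗ β ⊝ Q) ⊕ Q ⊗ (v ⊝ u))) refl
        (seq Q n) (seq α n) (seq β n) (seq (β ^ l) n)
        (seq (U (+ l)) n) (seq (U (+ suc l)) n) (seq (U i) n)
      where
      i≡l : i ≡ + l
      i≡l = ∙-cancelʳ (+ 1) i (+ l) (trans i+1≡l (cong +_ (ℕ.+-comm 1 l)))

    -- Multiplying by Q ^ m clears the denominators of Binet's formula for the
    -- possibly negative index i = l - m.
    Q^m*U-difference : ∀ m l i → i ℤ.+ + m ≡ + l →
      Q ^ m * U i ≃ β ^ m * U (+ l) - β ^ l * U (+ m)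
    Q^m*U-difference zero l i i+0≡l = linear-combination
      (β ^ l ∙ U₀ ⊞ 1ℝ ∙ U-cong i≡l)
      λ n → solve 4 (λ C u₀ u v → con 1ℚ ⊗ v ⊝ (con 1ℚ ⊗ u ⊝ C ⊗ u₀)
        := C ⊗ (u₀ ⊝ con 0ℚ) ⊕ con 1ℚ ⊗ (v ⊝ u)) refl
        (seq (β ^ l) n) (seq (U (+ 0)) n) (seq (U (+ l)) n) (seq (U i) n)
      where
      i≡l : i ≡ + l
      i≡l = trans (sym (ℤ.+-identityʳ i)) i+0≡l
    Q^m*U-difference (suc zero) l i i+1≡l = linear-combination
      (1ℝ ∙ Q*U-pred l i i+1≡l ⊞ β ^ l ∙ U₁)
      λ n → solve 6 (λ Q β C v u u₁ →
          Q ⊗ con 1ℚ ⊗ v ⊝ (β ⊗ con 1ℚ ⊗ u ⊝ C ⊗ u₁)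
        := con 1ℚ ⊗ (Q ⊗ v ⊝ (β ⊗ u ⊝ C)) ⊕ C ⊗ (u₁ ⊝ con 1ℚ)) refl
        (seq Q n) (seq β n) (seq (β ^ l) n) (seq (U i) n) (seq (U (+ l)) n) (seq (U (+ 1)) n)
    Q^m*U-difference (suc (suc m)) l i i+2+m≡l = linear-combination
      -- With `l` fixed, `i` rises as `m` falls, so the two earlier cases concern `U (i + 1)` and
      -- `U (i + 2)`. The recurrence at `i` combines them, and `β ^ 2 = P β - Q` merges the powers
      -- of `β`.
      (Q ^ suc m ∙ U-rec i
       ⊞ P ∙ Q^m*U-difference (suc m) l (i ℤ.+ + 1) (trans (ℤ.+-assoc i (+ 1) (+ suc m)) i+2+m≡l)
       ⊞ - Q ∙ Q^m*U-difference m l (i ℤ.+ + 2) (trans (ℤ.+-assoc i (+ 2) (+ m)) i+2+m≡l)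
       ⊞ - (β ^ m * U (+ l)) ∙ β-root
       ⊞ β ^ l ∙ U-rec-ℕ m)
      λ n → solve 13 (λ P Q β Qᵐ B C v₀ v₁ v₂ u u₀ u₁ u₂ →
          Q ⊗ (Q ⊗ Qᵐ) ⊗ v₀ ⊝ (β ⊗ (β ⊗ B) ⊗ u ⊝ C ⊗ u₂)
        := Q ⊗ Qᵐ ⊗ (v₂ ⊝ (P ⊗ v₁ ⊝ Q ⊗ v₀))
         ⊕ (P ⊗ (Q ⊗ Qᵐ ⊗ v₁ ⊝ (β ⊗ B ⊗ u ⊝ C ⊗ u₁))
         ⊕ ((⊝ Q) ⊗ (Qᵐ ⊗ v₂ ⊝ (B ⊗ u ⊝ C ⊗ u₀))
         ⊕ ((⊝ (B ⊗ u)) ⊗ ((β ⊗ (β ⊗ con 1ℚ) ⊝ P ⊗ β ⊕ Q) ⊝ con 0ℚ)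
         ⊕ C ⊗ (u₂ ⊝ (P ⊗ u₁ ⊝ Q ⊗ u₀)))))) refl
        (seq P n) (seq Q n) (seq β n) (seq (Q ^ m) n) (seq (β ^ m) n) (seq (β ^ l) n)
        (seq (U i) n) (seq (U (i ℤ.+ + 1)) n) (seq (U (i ℤ.+ + 2)) n)
        (seq (U (+ l)) n) (seq (U (+ m)) n) (seq (U (+ suc m)) n) (seq (U (+ suc (suc m))) n)

    -- By Binet's formula this is `1 / U m`, built before `U m` is known to be apart from 0. Its
    -- terms are explicit in those of `α` and `β`, as the decay estimate requires.
    recipU : ∀ m → .{{NonZero m}} → ℝ
    recipU m = (α - β) * inv (α ^ m - β ^ m) (α^m-β^m#0 m)

    U*recipU : ∀ m → .{{_ : NonZero m}} → U (+ m) * recipU m ≃ 1ℝ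
    U*recipU m = linear-combination (I ∙ binet m ⊞ 1ℝ ∙ *-inv (α ^ m - β ^ m) (α^m-β^m#0 m))
      λ n → solve 6 (λ α β A B u I → u ⊗ ((α ⊝ β) ⊗ I) ⊝ con 1ℚ
        := I ⊗ ((α ⊝ β) ⊗ u ⊝ (A ⊝ B)) ⊕ con 1ℚ ⊗ ((A ⊝ B) ⊗ I ⊝ con 1ℚ)) refl
        (seq α n) (seq β n) (seq (α ^ m) n) (seq (β ^ m) n) (seq (U (+ m)) n) (seq I n)
      where I = inv (α ^ m - β ^ m) (α^m-β^m#0 m)

    U#0 : ∀ m → .{{NonZero m}} → U (+ m) # 0ℝ
    U#0 m = invertible⇒apart (U (+ m)) (recipU m) (U*recipU m)

    UU#0 : ∀ m l → .{{NonZero m}} → .{{NonZero l}} → U (+ m) * U (+ l) # 0ℝ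
    UU#0 m l = invertible⇒apart (U (+ m) * U (+ l)) (recipU m * recipU l)
      (linear-combination (U (+ l) * recipU l ∙ U*recipU m ⊞ 1ℝ ∙ U*recipU l)
        λ n → solve 4 (λ u v x y → u ⊗ v ⊗ (x ⊗ y) ⊝ con 1ℚ
          := v ⊗ y ⊗ (u ⊗ x ⊝ con 1ℚ) ⊕ con 1ℚ ⊗ (v ⊗ y ⊝ con 1ℚ)) refl
          (seq (U (+ m)) n) (seq (U (+ l)) n) (seq (recipU m) n) (seq (recipU l) n))

    -- This is `Q^m*U-difference` divided by `U m * U l`. The three inverses come from independent
    -- apartness proofs and are related only through their defining equations.
    term-difference : ∀ m l (Uₘ#0 : U (+ m) # 0ℝ) (Uₗ#0 : U (+ l) # 0ℝ)
      (UₘUₗ#0 : U (+ m) * U (+ l) # 0ℝ) →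
      Q ^ m * (U (+ l ℤ.- + m) / (U (+ m) * U (+ l)) [ UₘUₗ#0 ])
        ≃ β ^ m / U (+ m) [ Uₘ#0 ] - β ^ l / U (+ l) [ Uₗ#0 ]
    term-difference m l Uₘ#0 Uₗ#0 UₘUₗ#0 = linear-combination
      (J ∙ Q^m*U-difference m l (+ l ℤ.- + m) l-m+m≡l
       ⊞ (β ^ m * Iₘ - β ^ l * Iₗ) ∙ *-inv (U (+ m) * U (+ l)) UₘUₗ#0
       ⊞ - (β ^ m * J * U (+ l)) ∙ *-inv (U (+ m)) Uₘ#0
       ⊞ β ^ l * J * U (+ m) ∙ *-inv (U (+ l)) Uₗ#0)
      λ n → solve 9 (λ Qᵐ B C v u w Iₘ Iₗ J → Qᵐ ⊗ (v ⊗ J) ⊝ (B ⊗ Iₘ ⊝ C ⊗ Iₗ)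
        := J ⊗ (Qᵐ ⊗ v ⊝ (B ⊗ w ⊝ C ⊗ u))
         ⊕ ((B ⊗ Iₘ ⊝ C ⊗ Iₗ) ⊗ (u ⊗ w ⊗ J ⊝ con 1ℚ)
         ⊕ ((⊝ (B ⊗ J ⊗ w)) ⊗ (u ⊗ Iₘ ⊝ con 1ℚ)
         ⊕ C ⊗ J ⊗ u ⊗ (w ⊗ Iₗ ⊝ con 1ℚ)))) refl
        (seq (Q ^ m) n) (seq (β ^ m) n) (seq (β ^ l) n) (seq (U (+ l ℤ.- + m)) n)
        (seq (U (+ m)) n) (seq (U (+ l)) n) (seq Iₘ n) (seq Iₗ n) (seq J n)
      where
      Iₘ = inv (U (+ m)) Uₘ#0
      Iₗ = inv (U (+ l)) Uₗ#0
      J  = inv (U (+ m) * U (+ l)) UₘUₗ#0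

      l-m+m≡l : + l ℤ.- + m ℤ.+ + m ≡ + l
      l-m+m≡l = trans (ℤ.+-assoc (+ l) (ℤ.- + m) (+ m))
        (trans (cong (λ i → + l ℤ.+ i) (ℤ.+-inverseˡ (+ m))) (ℤ.+-identityʳ (+ l)))

    β^m*recipU≃β^m/U : ∀ m → .{{_ : NonZero m}} → (Uₘ#0 : U (+ m) # 0ℝ) →
      β ^ m * recipU m ≃ β ^ m / U (+ m) [ Uₘ#0 ]
    β^m*recipU≃β^m/U m Uₘ#0 = linear-combination
      (β ^ m * I ∙ U*recipU m ⊞ - (β ^ m * recipU m) ∙ *-inv (U (+ m)) Uₘ#0)
      λ n → solve 4 (λ B u I V → B ⊗ V ⊝ B ⊗ I
        := B ⊗ I ⊗ (u ⊗ V ⊝ con 1ℚ) ⊕ (⊝ (B ⊗ V)) ⊗ (u ⊗ I ⊝ con 1ℚ)) refl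
        (seq (β ^ m) n) (seq (U (+ m)) n) (seq I n) (seq (recipU m) n)
      where I = inv (U (+ m)) Uₘ#0

    β^m*recipU-decay : ∀ m → .{{_ : NonZero m}} → Eventually λ n →
      (m ×ᵠ 1ℚ) ℚ.* δ ℚ.* ℚ.∣ seq (β ^ m * recipU m) n ∣ ℚ.≤ ℚ.∣ seq ((α - β) * β) n ∣
    β^m*recipU-decay m =
      -- Away from 0 the value of `recip` is a true reciprocal and not the default `0ℚ`.
      let c , 0<c , c≤∣W∣ = apart⇒bounded-below {α ^ m - β ^ m} (α^m-β^m#0 m) in
      ev-zip (λ n c≤Wₙ gapₙ → subst
          (λ q → (m ×ᵠ 1ℚ) ℚ.* δ ℚ.* ℚ.∣ q ℚ.* ((seq α n ℚ.- seq β n) ℚ.* recip (seq (α ^ m - β ^ m) n)) ∣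
                   ℚ.≤ ℚ.∣ seq ((α - β) * β) n ∣)
          (sym (seq-^ β m n))
          (quotient-decay 0<δ gapₙ m (subst₂
            (λ p q → (p ℚ.- q) ℚ.* recip (seq (α ^ m - β ^ m) n) ≡ 1ℚ)
            (seq-^ α m n) (seq-^ β m n) (*-recip (seq (α ^ m - β ^ m) n) 0<c c≤Wₙ))))
        c≤∣W∣ gap

    β^m*recipU-small : ∀ m → .{{_ : NonZero m}} → ∀ {ε C} →
      Eventually (λ n → ℚ.∣ seq ((α - β) * β) n ∣ ℚ.< C) →
      C ℚ.≤ (m ×ᵠ 1ℚ) ℚ.* (δ ℚ.* ε) →
      Eventually (λ n → ℚ.∣ seq (β ^ m * recipU m) n ∣ ℚ.< ε)
    β^m*recipU-small m {{m≢0}} {ε} {C} ∣Dβ∣<C C≤mδε =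
      ev-zip (λ n Dβ<C decay →
          ℚ.*-cancelˡ-<-nonNeg ((m ×ᵠ 1ℚ) ℚ.* δ)
            -- The bound `p≤m×1` at `0ℚ`, whose numerator is 0, gives `0 ≤ m × 1`.
            {{ℚ.nonNegative (nonNeg-* (p≤m×1 0ℚ {m} ℕ.z≤n) (ℚ.<⇒≤ 0<δ))}}
            (ℚ.≤-<-trans decay (ℚ.<-≤-trans Dβ<C
              (subst (C ℚ.≤_) (sym (ℚ.*-assoc (m ×ᵠ 1ℚ) δ ε)) C≤mδε))))
          ∣Dβ∣<C (β^m*recipU-decay m {{m≢0}})

    β^m/U-small : ∀ m → .{{_ : NonZero m}} → (Uₘ#0 : U (+ m) # 0ℝ) → ∀ {ε C} → 0ℚ ℚ.< ε →
      Eventually (λ n → ℚ.∣ seq ((α - β) * β) n ∣ ℚ.< C) →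
      C ℚ.≤ (m ×ᵠ 1ℚ) ℚ.* (δ ℚ.* (ε ℚ.* ½)) →
      Eventually (λ n → ℚ.∣ seq (β ^ m / U (+ m) [ Uₘ#0 ]) n ∣ ℚ.< ε)
    β^m/U-small m {{m≢0}} Uₘ#0 {ε} {C} 0<ε ∣Dβ∣<C C≤mδ½ε =
      -- Bound by let so that its type is inferred before it meets the goal, which
      -- Agda could only unify with metavariables by unfolding inv.
      let small = small-resp-≃ {ε = ε} (β^m*recipU≃β^m/U m {{m≢0}} Uₘ#0) 0<ε
                    (β^m*recipU-small m {{m≢0}} ∣Dβ∣<C C≤mδ½ε)
      in small

    null-β^a/U : ∀ {a : ℕ → ℕ} (a≢0 : ∀ i → NonZero (a i)) → TendsToInfinity a →
      (Ua#0 : ∀ i → U (+ a i) # 0ℝ) → Null (λ i → β ^ a i / U (+ a i) [ Ua#0 i ])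
    null-β^a/U {a} a≢0 a→∞ Ua#0 ε 0<ε =
      -- `C` and hence `M` are independent of `i`, so `M ≤ a i` suffices. The factor `½` pays for
      -- replacing `recipU` by the quotient.
      let C , 0<C , ∣Dβ∣<C = eventually-bounded ((α - β) * β)
          M , C≤mδ½ε       = archimedean C 0<C (pos-* 0<δ (0<½* 0<ε))
      in ev-map (λ i M≤aᵢ → β^m/U-small (a i) {{a≢0 i}} (Ua#0 i) 0<ε ∣Dβ∣<C (C≤mδ½ε (a i) M≤aᵢ))
           (a→∞ M)

-- Carries a sequence as a type parameter.  A λ-abstraction with an irrelevant
-- instance argument passed directly to sumsTo-telescope is not recognised as
-- syntactically equal to the one in the goal, and Agda then unfolds ℝ.
data Summand (f : (n : ℕ) → .{{NonZero n}} → ℝ) : Set where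
  summand : Summand f

-- The error of a partial sum is minus a sum of `k` shifts of one null sequence, with `k` fixed.
sumsTo-telescope : ∀ {f g : (n : ℕ) → .{{NonZero n}} → ℝ} {k} → Summand f → Summand g →
  (∀ i → f (suc i) ≃ g (suc i) - g (suc i ℕ.+ k) {{_}}) → Null (λ i → g (suc i)) →
  SumsTo f (Σ₁ k g)
sumsTo-telescope {f} {g} {k} _ _ f≃Δg g-null = null⇒⟶ {λ N → Σ₁ N f} {Σ₁ k g}
  (null-resp-≃ {λ N → - tail N} {λ N → Σ₁ N f - Σ₁ k g} -tail≃ (null-neg {tail} tail-null))
  where
  tail : ℕ → ℝ
  tail N = sum {k} (λ i → g (suc (N ℕ.+ toℕ i)))

  -tail≃ : ∀ N → - tail N ≃ Σ₁ N f - Σ₁ k g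
  -tail≃ N = linear-combination
    (- 1ℝ ∙ sum-telescope N k (λ i → g (suc i)) (λ i → g (suc i ℕ.+ k) {{_}}) (λ i → f (suc i))
              f≃Δg (λ _ → refl))
    λ n → solve 3 (λ s t l → (⊝ t) ⊝ (s ⊝ l) := (⊝ con 1ℚ) ⊗ ((s ⊕ t) ⊝ l)) refl
      (seq (Σ₁ N f) n) (seq (tail N) n) (seq (Σ₁ k g) n)

  tail-null : Null tail
  tail-null = null-sum k {λ i N → g (suc (N ℕ.+ toℕ i))}
    (λ i → null-shift {λ j → g (suc j)} g-null (toℕ i))

theorem2p1 : (P Q : ℝ) → P # 0ℝ → Q # 0ℝ → 0ℝ < P ^ 2 - fromℚ (+ 4 ℚ./ 1) * Q →
    (α β : ℝ) → IsRoot P Q α → IsRoot P Q β → ∣ β ∣ < ∣ α ∣ →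
    (U : ℤ → ℝ) → IsLucas P Q U →
    (a : ℕ → ℕ) → (∀ n → .{{NonZero n}} → 0 ℕ.< a n) → TendsToInfinity a →
    (k : ℕ) → .{{NonZero k}} →
    Σ[ Ua#0 ∈ (∀ n → .{{NonZero n}} → U (+ a n) # 0ℝ) ]
    Σ[ UaUa#0 ∈ (∀ n → .{{NonZero n}} → U (+ a n) * U (+ a (n ℕ.+ k)) # 0ℝ) ]
    SumsTo
    (λ n → Q ^ a n * (U (+ a (n ℕ.+ k) ℤ.- + a n) / (U (+ a n) * U (+ a (n ℕ.+ k))) [ UaUa#0 n ]))
    (Σ₁ k (λ n → β ^ a n / U (+ a n) [ Ua#0 n ]))
theorem2p1 P Q _ _ _ α β α-root β-root (δ , 0<δ , gap) U lucas a a>0 a→∞ k =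
  Ua#0 , UaUa#0 , converges
  where
  α-root′ : α ^ 2 - P * α + Q ≃ 0ℝ
  α-root′ = ⟪ α-root ⟫

  β-root′ : β ^ 2 - P * β + Q ≃ 0ℝ
  β-root′ = ⟪ β-root ⟫

  u₀ : U (+ 0) ≃ 0ℝ
  u₀ = ⟪ IsLucas.U₀ lucas ⟫

  u₁ : U (+ 1) ≃ 1ℝ
  u₁ = ⟪ IsLucas.U₁ lucas ⟫

  u-rec : ∀ i → U (i ℤ.+ + 2) ≃ P * U (i ℤ.+ + 1) - Q * U i
  u-rec i = ⟪ IsLucas.recurrence lucas i ⟫

  module L = DominantRoot.Lucas P Q α β α-root′ β-root′ 0<δ gap U u₀ u₁ u-rec

  a≢0 : ∀ n → .{{NonZero n}} → NonZero (a n)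
  a≢0 n = ℕ.>-nonZero (a>0 n)

  -- The series starts at index 1, whereas `Null` sequences are indexed from 0.
  a∘suc→∞ : TendsToInfinity (λ i → a (suc i))
  a∘suc→∞ M with a→∞ M
  ... | N , h = N , λ i N≤i → h (suc i) (ℕ.m≤n⇒m≤1+n N≤i)

  Ua#0 : ∀ n → .{{NonZero n}} → U (+ a n) # 0ℝ
  Ua#0 n = L.U#0 (a n) {{a≢0 n}}

  UaUa#0 : ∀ n → .{{NonZero n}} → U (+ a n) * U (+ a (n ℕ.+ k)) # 0ℝ
  UaUa#0 n = L.UU#0 (a n) (a (n ℕ.+ k))
    {{a≢0 n}} {{a≢0 (n ℕ.+ k) {{ℕ.>-nonZero (ℕ.<-≤-trans (ℕ.>-nonZero⁻¹ n) (ℕ.m≤m+n n k))}}}}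

  term : Summand (λ n → Q ^ a n * (U (+ a (n ℕ.+ k) ℤ.- + a n) / (U (+ a n) * U (+ a (n ℕ.+ k))) [ UaUa#0 n ]))
  term = summand

  limit : Summand (λ n → β ^ a n / U (+ a n) [ Ua#0 n ])
  limit = summand

  converges = sumsTo-telescope term limit
    (λ i → L.term-difference (a (suc i)) (a (suc i ℕ.+ k))
             (Ua#0 (suc i)) (Ua#0 (suc i ℕ.+ k)) (UaUa#0 (suc i)))
    (L.null-β^a/U {λ i → a (suc i)} (λ i → a≢0 (suc i)) a∘suc→∞ (λ i → Ua#0 (suc i)))
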